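{- Let $\mathcal{R}$ be a relational domain over the finite set of variables $\mathcal{X}$ that is 2-nice and satisfies $(r_1\sqcup r_2)|_p=r_1|_p\sqcup r_2|_p$ for all $r_1,r_2\in\mathcal{R}$ and $p\in[\mathcal{X}]_2$. Then the domain $\mathcal{R}_2^\sharp$ of all stable collections over $\mathcal{R}$, with ordering $\sqsubseteq^\sharp$, join $\sqcup^\sharp$, meet $\sqcap^\sharp$ and restriction $R\mapsto R|^\sharp_Y$, is a 2-decomposable relational domain.
   Context: $[\mathcal{X}]_2$ denotes the set of all non-empty subsets of $\mathcal{X}$ of size at most $2$. A relational domain (over $\mathcal{X}$) is a bounded lattice $(\mathcal{R},\sqsubseteq,\bot,\top,\sqcap,\sqcup)$ (not necessarily complete) together with, for each $Y\subseteq\mathcal{X}$, a monotone restriction operation $r\mapsto r|_Y$ on $\mathcal{R}$ satisfying: $r|_{\mathcal{X}}=r$; $r|_\emptyset=\bot$ if $r=\bot$ and $r|_\emptyset=\top$ otherwise; $r|_{Y_1}\sqsupseteq r|_{Y_2}$ whenever $Y_1\subseteq Y_2$; and $(r|_{Y_1})|_{Y_2}=r|_{Y_1\cap Y_2}$. (A relational domain also comes with monotone transformers for assignments and guards over some expression and condition language, which are not constrained by any axiom; being a relational domain is understood here as a statement about the bounded lattice and the restriction.) For $Y\subseteq\mathcal{X}$, $\mathcal{R}^Y=\{r|_Y\mid r\in\mathcal{R}\}$. A relational domain $\mathcal{R}$ is 2-decomposable if $r=\mathop{\sqcap}_{p\in[\mathcal{X}]_2} r|_p$ for all $r\in\mathcal{R}$,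 and $(r_1\sqcup r_2)|_p=r_1|_p\sqcup r_2|_p$ for all $r_1,r_2\in\mathcal{R}$ and $p\in[\mathcal{X}]_2$. For a collection $\langle s_p\rangle_{p\in[\mathcal{X}]_2}$ with $s_p\in\mathcal{R}^p$, the constraint system $\mathrm{CS}(\langle s_p\rangle)$ in unknowns $r_p\in\mathcal{R}^p$, $p\in[\mathcal{X}]_2$, consists of the constraints $r_{\{x,y\}}\sqsubseteq s_{\{x,y\}}$ ($x,y\in\mathcal{X}$) and $r_{\{x,y\}}\sqsubseteq (r_{\{x,z\}}\sqcap r_{\{z,y\}})|_{\{x,y\}}$ ($x,y,z\in\mathcal{X}$). Solutions are ordered componentwise. $\mathcal{R}$ is 2-nice if for every collection $\langle s_p\rangle_{p\in[\mathcal{X}]_2}$ with $s_p\in\mathcal{R}^p$, the system $\mathrm{CS}(\langle s_p\rangle)$ has a greatest solution which is attained by Kleene fixpoint iteration (iterating simultaneously, from $r_p=\top$ for all $p$, the meet of all right-hand sides for each $r_p$) after finitely many rounds. A collection $R=\langle r_p\rangle_{p\in[\mathcal{X}]_2}$ with $r_p\in\mathcal{R}^p$ is stable if it is a solution of $\mathrm{CS}(\langle s_p\rangle)$ with $s_p=r_p$. $\mathcal{R}_2^\sharp$ is the set of all stable collections, ordered componentwise: $\langle r_p\rangle\sqsubseteq^\sharp\langle r'_p\rangle$ iff $r_p\sqsubseteq r'_p$ for all $p$. For $R=\langle r_p\rangle$, $R'=\langle r'_p\rangle$ in $\mathcal{R}_2^\sharp$ and $Y\subseteq\mathcal{X}$: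 $R\sqcup^\sharp R'=\langle r_p\sqcup r'_p\rangle_{p}$; $R\sqcap^\sharp R'$ is the greatest solution of $\mathrm{CS}(\langle r_p\sqcap r'_p\rangle)$; and $R|^\sharp_Y=\langle r_p|_Y\rangle_{p}=\langle r_p|_{Y\cap p}\rangle_{p}$. -}

module Defs where

open import Algebra.Core using (Op₂)
open import Data.Bool.Properties using () renaming (_≟_ to _≟ᵇ_)
open import Data.Fin.Base using (Fin; zero; suc)
open import Data.Fin.Subset using (Subset; ⁅_⁆; _∪_; _∩_; _⊆_; ∣_∣; Nonempty; inside; outside) renaming (⊥ to ∅; ⊤ to 𝒳)
open import Data.Fin.Subset.Properties using (x∈⁅x⁆; x∈p∪q⁺; ∪-identityˡ; ∪-idem; ∣⁅x⁆∣≡1; nonempty?)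
open import Data.List.Base using (List; _∷_; map; foldr; filter; allFin; cartesianProduct; cartesianProductWith)
open import Data.List.Membership.Propositional using () renaming (_∈_ to _∈ˡ_)
open import Data.List.Membership.Propositional.Properties using (∈-cartesianProductWith⁺; ∈-allFin)
open import Data.Nat.Base using (ℕ; zero; suc; _+_; _≤_; s≤s; z≤n)
open import Data.Nat.Properties using (≤-trans; ≤-reflexive; +-mono-≤; +-monoʳ-≤; n≤1+n; ≤-pred; +-suc; _≤?_)
open import Data.Product.Base using (_×_; _,_; ∃-syntax)
open import Data.Sum.Base using (inj₁)
open import Data.Vec.Base using ([]; _∷_; here; there)
open import Data.Vec.Properties using (≡-dec)
open import Level using (Level; _⊔_) renaming (suc to lsuc)
open import Relation.Binary.Core using (Rel)
open import Relation.Binary.Definitions using (DecidableEquality)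
open import Relation.Binary.Lattice.Structures using (IsBoundedLattice)
open import Relation.Binary.PropositionalEquality using (_≡_; refl; cong; sym; trans)
open import Relation.Nullary using (¬_; yes; no)
open import Relation.Nullary.Decidable using (recompute)
open import Relation.Nullary.Negation using (contradiction)

-- [ n ]₂ is [𝒳]₂ for 𝒳 = Fin n. The proofs are irrelevant, so an element
-- is determined by its underlying subset.

record [_]₂ (n : ℕ) : Set where
  constructor mk
  field
    subset     : Subset n
    .nonempty  : Nonempty subset
    .size≤2    : ∣ subset ∣ ≤ 2

open [_]₂ public using (subset)

∣p∪q∣≤∣p∣+∣q∣ : ∀ {n} (p q : Subset n) → ∣ p ∪ q ∣ ≤ ∣ p ∣ + ∣ q ∣
∣p∪q∣≤∣p∣+∣q∣ []            []            = z≤n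
∣p∪q∣≤∣p∣+∣q∣ (outside ∷ p) (outside ∷ q) = ∣p∪q∣≤∣p∣+∣q∣ p q
∣p∪q∣≤∣p∣+∣q∣ (outside ∷ p) (inside  ∷ q) =
  ≤-trans (s≤s (∣p∪q∣≤∣p∣+∣q∣ p q)) (≤-reflexive (sym (+-suc ∣ p ∣ ∣ q ∣)))
∣p∪q∣≤∣p∣+∣q∣ (inside  ∷ p) (outside ∷ q) = s≤s (∣p∪q∣≤∣p∣+∣q∣ p q)
∣p∪q∣≤∣p∣+∣q∣ (inside  ∷ p) (inside  ∷ q) =
  s≤s (≤-trans (∣p∪q∣≤∣p∣+∣q∣ p q) (+-monoʳ-≤ ∣ p ∣ (n≤1+n ∣ q ∣)))

⟅_,_⟆ : ∀ {n} → Fin n → Fin n → [ n ]₂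
⟅ x , y ⟆ = mk (⁅ x ⁆ ∪ ⁅ y ⁆)
  (x , x∈p∪q⁺ (inj₁ (x∈⁅x⁆ x)))
  (≤-trans (∣p∪q∣≤∣p∣+∣q∣ ⁅ x ⁆ ⁅ y ⁆)
           (+-mono-≤ (≤-reflexive (∣⁅x⁆∣≡1 x)) (≤-reflexive (∣⁅x⁆∣≡1 y))))

-- Two-element sets are listed twice; only meets are taken over this list.

pairs : ∀ n → List [ n ]₂
pairs n = cartesianProductWith ⟅_,_⟆ (allFin n) (allFin n)

private
  size0 : ∀ {n} (p : Subset n) → ∣ p ∣ ≤ 0 → p ≡ ∅
  size0 []            _ = refl
  size0 (outside ∷ p) h = cong (outside ∷_) (size0 p h)

  size1 : ∀ {n} (p : Subset n) → Nonempty p → ∣ p ∣ ≤ 1 → ∃[ x ] p ≡ ⁅ x ⁆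
  size1 (inside  ∷ p) _                 h = zero , cong (inside ∷_) (size0 p (≤-pred h))
  size1 (outside ∷ p) (suc x , there i) h =
    let y , eq = size1 p (x , i) h in suc y , cong (outside ∷_) eq

  size2 : ∀ {n} (p : Subset n) → Nonempty p → ∣ p ∣ ≤ 2 →
          ∃[ x ] ∃[ y ] p ≡ ⁅ x ⁆ ∪ ⁅ y ⁆
  size2 (outside ∷ p) (suc x , there i) h =
    let y , z , eq = size2 p (x , i) h in suc y , suc z , cong (outside ∷_) eq
  size2 (inside ∷ p) _ h with nonempty? p
  ... | yes ne = let y , eq = size1 p ne (≤-pred h) in
                 zero , suc y , cong (inside ∷_) (trans eq (sym (∪-identityˡ ⁅ y ⁆)))
  ... | no  ¬ne = zero , zero , cong (inside ∷_) (trans (empty p ¬ne) (sym (∪-idem ∅)))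
    where
    empty : ∀ {m} (q : Subset m) → ¬ Nonempty q → q ≡ ∅
    empty []            _  = refl
    empty (inside  ∷ q) ¬q = contradiction (zero , here) ¬q
    empty (outside ∷ q) ¬q = cong (outside ∷_) (empty q λ (x , i) → ¬q (suc x , there i))

∈-pairs : ∀ {n} (p : [ n ]₂) → p ∈ˡ pairs n
∈-pairs {n} (mk p ne sz) = go (recompute-Nonempty ne) (recompute-≤ sz)
  where
  recompute-Nonempty : .(Nonempty p) → Nonempty p
  recompute-Nonempty = recompute (nonempty? p)

  recompute-≤ : .(∣ p ∣ ≤ 2) → ∣ p ∣ ≤ 2
  recompute-≤ = recompute (∣ p ∣ ≤? 2)

  go : Nonempty p → ∣ p ∣ ≤ 2 → mk p ne sz ∈ˡ pairs n
  go ne′ sz′ with size2 p ne′ sz′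
  ... | x , y , refl = ∈-cartesianProductWith⁺ ⟅_,_⟆ (∈-allFin x) (∈-allFin y)

_≟ˢ_ : ∀ {n} → DecidableEquality (Subset n)
_≟ˢ_ = ≡-dec _≟ᵇ_

RestrictionPreservesJoins : ∀ {a ℓ} {n : ℕ} {A : Set a} →
  Rel A ℓ → Op₂ A → (A → Subset n → A) → Set (a ⊔ ℓ)
RestrictionPreservesJoins {n = n} _≈_ _∨_ _↾_ =
  ∀ r₁ r₂ (p : [ n ]₂) →
  ((r₁ ∨ r₂) ↾ subset p) ≈ ((r₁ ↾ subset p) ∨ (r₂ ↾ subset p))

module _ {a ℓ₁ ℓ₂ : Level} {n : ℕ} {A : Set a}
         (_≈_ : Rel A ℓ₁) (_⊑_ : Rel A ℓ₂)
         (_∨_ _∧_ : Op₂ A) (⊤ ⊥ : A)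
         (_↾_ : A → Subset n → A)
  where

  record IsRelationalDomain : Set (a ⊔ ℓ₁ ⊔ ℓ₂) where
    field
      isBoundedLattice : IsBoundedLattice _≈_ _⊑_ _∨_ _∧_ ⊤ ⊥
      ↾-mono           : ∀ Y {r s} → r ⊑ s → (r ↾ Y) ⊑ (s ↾ Y)
      ↾-𝒳              : ∀ r → (r ↾ 𝒳) ≈ r
      ↾-∅-⊥            : ∀ r → r ≈ ⊥ → (r ↾ ∅) ≈ ⊥
      ↾-∅-⊤            : ∀ r → ¬ (r ≈ ⊥) → (r ↾ ∅) ≈ ⊤
      ↾-antitone       : ∀ r {Y₁ Y₂} → Y₁ ⊆ Y₂ → (r ↾ Y₂) ⊑ (r ↾ Y₁)
      ↾-↾              : ∀ r Y₁ Y₂ → ((r ↾ Y₁) ↾ Y₂) ≈ (r ↾ (Y₁ ∩ Y₂))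

  record Is2DecomposableRelationalDomain : Set (a ⊔ ℓ₁ ⊔ ℓ₂) where
    field
      isRelationalDomain        : IsRelationalDomain
      decomposes                : ∀ r → r ≈ foldr _∧_ ⊤ (map (λ p → r ↾ subset p) (pairs n))
      restrictionPreservesJoins : RestrictionPreservesJoins _≈_ _∨_ _↾_

record RelationalDomain (n : ℕ) (c ℓ₁ ℓ₂ : Level) : Set (lsuc (c ⊔ ℓ₁ ⊔ ℓ₂)) where
  infix  4 _≈_ _⊑_
  infixr 6 _∨_
  infixr 7 _∧_
  infixl 8 _↾_
  field
    Carrier            : Set c
    _≈_                : Rel Carrier ℓ₁
    _⊑_                : Rel Carrier ℓ₂
    _∨_                : Op₂ Carrier
    _∧_                : Op₂ Carrier
    ⊤                  : Carrier
    ⊥                  : Carrier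
    _↾_                : Carrier → Subset n → Carrier
    isRelationalDomain : IsRelationalDomain _≈_ _⊑_ _∨_ _∧_ ⊤ ⊥ _↾_

  open IsRelationalDomain isRelationalDomain public

module _ {n : ℕ} {c ℓ₁ ℓ₂ : Level} (R : RelationalDomain n c ℓ₁ ℓ₂) where
  open RelationalDomain R

  PreservesJoins : Set (c ⊔ ℓ₁)
  PreservesJoins = RestrictionPreservesJoins _≈_ _∨_ _↾_

  _∈ℛ^_ : Carrier → Subset n → Set (c ⊔ ℓ₁)
  s ∈ℛ^ Y = ∃[ r ] s ≈ r ↾ Y

  Family : Set c
  Family = [ n ]₂ → Carrier

  IsCollection : Family → Set (c ⊔ ℓ₁)
  IsCollection r = ∀ p → r p ∈ℛ^ subset p

  viaThird : Family → Fin n → Fin n → Fin n → Carrier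
  viaThird r x y z = (r ⟅ x , z ⟆ ∧ r ⟅ z , y ⟆) ↾ subset ⟅ x , y ⟆

  record IsSolution (s r : Family) : Set (c ⊔ ℓ₁ ⊔ ℓ₂) where
    field
      isCollection : IsCollection r
      bounded      : ∀ x y → r ⟅ x , y ⟆ ⊑ s ⟅ x , y ⟆
      consistent   : ∀ x y z → r ⟅ x , y ⟆ ⊑ viaThird r x y z

  IsGreatestSolution : (s g : Family) → Set (c ⊔ ℓ₁ ⊔ ℓ₂)
  IsGreatestSolution s g = IsSolution s g × (∀ r → IsSolution s r → ∀ p → r p ⊑ g p)

  triples : List (Fin n × Fin n × Fin n)
  triples = cartesianProduct (allFin n) (cartesianProduct (allFin n) (allFin n))

  -- The unknown r_p is constrained by every (x , y , z) with {x , y} = p.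

  rightHandSides : (s r : Family) → [ n ]₂ → List Carrier
  rightHandSides s r p =
    s p ∷ map (λ (x , y , z) → viaThird r x y z)
              (filter (λ (x , y , z) → subset ⟅ x , y ⟆ ≟ˢ subset p) triples)

  kleene : Family → ℕ → Family
  kleene s zero    p = ⊤
  kleene s (suc k) p = foldr _∧_ ⊤ (rightHandSides s (kleene s k) p)

  2-Nice : Set (c ⊔ ℓ₁ ⊔ ℓ₂)
  2-Nice = ∀ s → IsCollection s →
    ∃[ g ] IsGreatestSolution s g × ∃[ k ] (∀ p → kleene s k p ≈ g p)

  record Stable : Set (c ⊔ ℓ₁ ⊔ ℓ₂) where
    field
      at       : Family
      isStable : IsSolution at at

  open Stable public using (at)

  _≈♯_ : Rel Stable ℓ₁
  r ≈♯ r′ = ∀ p → at r p ≈ at r′ p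

  _⊑♯_ : Rel Stable ℓ₂
  r ⊑♯ r′ = ∀ p → at r p ⊑ at r′ p

  -- That stable collections are closed under these operations is part of
  -- exhibiting an element of this record. Each operation is determined by its
  -- specification up to _≈♯_.

  record StableOperations : Set (c ⊔ ℓ₁ ⊔ ℓ₂) where
    field
      _∨♯_    : Op₂ Stable
      _∧♯_    : Op₂ Stable
      _↾♯_    : Stable → Subset n → Stable
      ∨♯-spec : ∀ r r′ p → at (r ∨♯ r′) p ≈ at r p ∨ at r′ p
      ∧♯-spec : ∀ r r′ → IsGreatestSolution (λ p → at r p ∧ at r′ p) (at (r ∧♯ r′))
      ↾♯-spec : ∀ r Y p → at (r ↾♯ Y) p ≈ at r p ↾ Y

{-# OPTIONS --safe #-}
module Submission where

-- Order, join, restriction and bounds of stable collections are all taken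
-- componentwise, so most laws are inherited from the components. What needs
-- an argument is closure of the stable collections under the operations, the
-- meet, the law for restriction to the empty set, and decomposition.
--
-- Closure. An element s lies in the image of restriction to p exactly when
-- s ≈ s ↾ p (≈↾⇒∈ℛ, ∈ℛ⇒≈↾). Hence these images are closed under meets, under
-- further restriction and, since restriction to p preserves joins, under joins.
-- Consistency passes to joins by monotonicity, and to restrictions because
-- restrictions commute and (u ∧ v) ↾ Y ⊑ (u ↾ Y) ∧ (v ↾ Y).
--
-- Meet. The meet of two stable collections is the greatest solution of
-- the system bounded by their componentwise meets, which exists by 2-niceness.
-- The solutions that are compared with it in the universal property of the meet
-- are exactly the stable collections below both arguments.
--
-- Restriction to the empty set. If one component of a stable collection is ⊥,
-- then two applications of consistency make all of them ⊥ (⊥-spreads). So in a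
-- collection other than ⊥♯ no component is ⊥, and each becomes ⊤ when
-- restricted to the empty set. This argument needs no decidability.
--
-- Decomposition. A collection r lies below each of its restrictions, hence
-- below their meet. Conversely the meet lies below r ↾♯ q for each q, whose
-- component at q is r_q ↾ q ≈ r_q.

open import Defs
open import Data.Fin.Subset using (Subset) renaming (⊥ to ∅)
open import Data.Fin.Subset.Properties using (∩-comm; ∩-idem; ⊆-max; ⊆-min)
open import Data.List.Base using (List; []; _∷_; foldr; map; allFin)
open import Data.List.Membership.Propositional using (_∈_)
open import Data.List.Membership.Propositional.Properties
  using (∈-cartesianProductWith⁻; ∈-map⁺; ∈-map⁻)
open import Data.List.Relation.Unary.Any using (here; there)
open import Data.Nat.Base using (ℕ)
open import Data.Product.Base using (Σ-syntax; ∃-syntax; _,_; proj₁; proj₂)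
open import Level using (Level)
open import Relation.Binary.Core using (Rel)
open import Relation.Binary.Lattice.Structures using (IsBoundedLattice)
open import Relation.Binary.PropositionalEquality as ≡ using ()
open import Relation.Nullary using (¬_)

-- [𝒳]₂ consists of the sets {x , y}, so constraints indexed by x and y cover
-- every p.

[]₂-elim : ∀ {n a} (P : [ n ]₂ → Set a) → (∀ x y → P ⟅ x , y ⟆) → ∀ p → P p
[]₂-elim {n} P h p
  with ∈-cartesianProductWith⁻ ⟅_,_⟆ (allFin n) (allFin n) (∈-pairs p)
... | x , y , _ , _ , ≡.refl = h x y

-- The fold foldr _∧_ ⊤ xs is the greatest lower bound of the entries of xs.

module FiniteMeet {a ℓ₁ ℓ₂} {A : Set a} {_≈_ : Rel A ℓ₁} {_⊑_ : Rel A ℓ₂}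
  {_∨_ _∧_ : A → A → A} {⊤ ⊥ : A} (L : IsBoundedLattice _≈_ _⊑_ _∨_ _∧_ ⊤ ⊥)
  where
  open IsBoundedLattice L

  ⋀-lower : ∀ {x xs} → x ∈ xs → foldr _∧_ ⊤ xs ⊑ x
  ⋀-lower (here ≡.refl) = x∧y≤x _ _
  ⋀-lower (there x∈xs)  = trans (x∧y≤y _ _) (⋀-lower x∈xs)

  ⋀-greatest : ∀ {z} xs → (∀ {x} → x ∈ xs → z ⊑ x) → z ⊑ foldr _∧_ ⊤ xs
  ⋀-greatest []       _ = maximum _
  ⋀-greatest (x ∷ xs) h =
    ∧-greatest (h (here ≡.refl)) (⋀-greatest xs λ x∈xs → h (there x∈xs))

module StableDomain {c ℓ₁ ℓ₂ : Level} {n : ℕ} (R : RelationalDomain n c ℓ₁ ℓ₂) where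

  open RelationalDomain R
  open IsBoundedLattice isBoundedLattice
    using (antisym; trans; refl; reflexive; maximum; minimum; module Eq;
           x≤x∨y; y≤x∨y; ∨-least; x∧y≤x; x∧y≤y; ∧-greatest)
  open IsSolution using (isCollection; bounded; consistent)
  open Stable using (isStable)

  -- Restriction and the images ℛ^Y

  ↾-cong : ∀ Y {r s} → r ≈ s → r ↾ Y ≈ s ↾ Y
  ↾-cong Y r≈s =
    antisym (↾-mono Y (reflexive r≈s)) (↾-mono Y (reflexive (Eq.sym r≈s)))

  ↾-extensive : ∀ r Y → r ⊑ r ↾ Y
  ↾-extensive r Y = trans (reflexive (Eq.sym (↾-𝒳 r))) (↾-antitone r (⊆-max Y))

  ↾-⊥ : ∀ Y → ⊥ ↾ Y ≈ ⊥
  ↾-⊥ Y = antisym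
    (trans (↾-antitone ⊥ (⊆-min Y)) (reflexive (↾-∅-⊥ ⊥ Eq.refl)))
    (minimum _)

  ↾-⊤ : ∀ Y → ⊤ ↾ Y ≈ ⊤
  ↾-⊤ Y = antisym (maximum _) (↾-extensive ⊤ Y)

  ↾-comm : ∀ r Y Z → r ↾ Y ↾ Z ≈ r ↾ Z ↾ Y
  ↾-comm r Y Z = Eq.trans (↾-↾ r Y Z)
    (Eq.trans (Eq.reflexive (≡.cong (r ↾_) (∩-comm Y Z))) (Eq.sym (↾-↾ r Z Y)))

  ↾-∧ : ∀ r s Y → (r ∧ s) ↾ Y ⊑ r ↾ Y ∧ s ↾ Y
  ↾-∧ r s Y = ∧-greatest (↾-mono Y (x∧y≤x r s)) (↾-mono Y (x∧y≤y r s))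

  ∈ℛ⇒≈↾ : ∀ {s Y} → (R ∈ℛ^ s) Y → s ≈ s ↾ Y
  ∈ℛ⇒≈↾ {s} {Y} (r , s≈r↾Y) = Eq.trans s≈r↾Y (Eq.sym (Eq.trans (↾-cong Y s≈r↾Y)
    (Eq.trans (↾-↾ r Y Y) (Eq.reflexive (≡.cong (r ↾_) (∩-idem Y))))))

  ≈↾⇒∈ℛ : ∀ {s Y} → s ≈ s ↾ Y → (R ∈ℛ^ s) Y
  ≈↾⇒∈ℛ {s} s≈s↾Y = s , s≈s↾Y

  ∧-∈ℛ : ∀ {s t Y} → (R ∈ℛ^ s) Y → (R ∈ℛ^ t) Y → (R ∈ℛ^ (s ∧ t)) Y
  ∧-∈ℛ {s} {t} {Y} s∈ t∈ = ≈↾⇒∈ℛ (antisym (↾-extensive (s ∧ t) Y) (∧-greatest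
    (trans (↾-mono Y (x∧y≤x s t)) (reflexive (Eq.sym (∈ℛ⇒≈↾ s∈))))
    (trans (↾-mono Y (x∧y≤y s t)) (reflexive (Eq.sym (∈ℛ⇒≈↾ t∈))))))

  ∨-∈ℛ : PreservesJoins R → ∀ {s t} (p : [ n ]₂) →
         (R ∈ℛ^ s) (subset p) → (R ∈ℛ^ t) (subset p) → (R ∈ℛ^ (s ∨ t)) (subset p)
  ∨-∈ℛ ↾-∨ {s} {t} p s∈ t∈ = ≈↾⇒∈ℛ (antisym (↾-extensive (s ∨ t) (subset p))
    (trans (reflexive (↾-∨ s t p)) (∨-least
      (trans (reflexive (Eq.sym (∈ℛ⇒≈↾ s∈))) (x≤x∨y s t))
      (trans (reflexive (Eq.sym (∈ℛ⇒≈↾ t∈))) (y≤x∨y s t)))))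

  ↾-∈ℛ : ∀ {s Y} Z → (R ∈ℛ^ s) Y → (R ∈ℛ^ (s ↾ Z)) Y
  ↾-∈ℛ {s} {Y} Z s∈ = ≈↾⇒∈ℛ (Eq.trans (↾-cong Z (∈ℛ⇒≈↾ s∈)) (↾-comm s Y Z))

  -- Stable collections

  viaThird-mono : ∀ {r s : Family R} → (∀ p → r p ⊑ s p) →
                  ∀ x y z → viaThird R r x y z ⊑ viaThird R s x y z
  viaThird-mono r⊑s x y z = ↾-mono _
    (∧-greatest (trans (x∧y≤x _ _) (r⊑s _)) (trans (x∧y≤y _ _) (r⊑s _)))

  solution⇒stable : ∀ {s r} → IsSolution R s r → Stable R
  solution⇒stable {r = r} sol = record
    { at       = r
    ; isStable = record
      { isCollection = isCollection sol
      ; bounded      = λ _ _ → refl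
      ; consistent   = consistent sol
      }
    }

  solution-⊑ : ∀ {s r} → IsSolution R s r → ∀ p → r p ⊑ s p
  solution-⊑ {s} {r} sol = []₂-elim (λ p → r p ⊑ s p) (bounded sol)

  -- The solutions of CS(s) are the stable collections below s.
  stable⇒solution : ∀ {s} (r : Stable R) → (∀ p → at r p ⊑ s p) →
                    IsSolution R s (at r)
  stable⇒solution r r⊑s = record
    { isCollection = isCollection (isStable r)
    ; bounded      = λ x y → r⊑s ⟅ x , y ⟆
    ; consistent   = consistent (isStable r)
    }

  -- The bounds, restriction and join of stable collections are componentwise.

  ⊤♯ : Stable R
  ⊤♯ = record
    { at       = λ _ → ⊤
    ; isStable = record
      { isCollection = λ p → ≈↾⇒∈ℛ (Eq.sym (↾-⊤ (subset p)))
      ; bounded      = λ _ _ → refl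
      ; consistent   = λ _ _ _ → trans (∧-greatest refl refl) (↾-extensive (⊤ ∧ ⊤) _)
      }
    }

  ⊥♯ : Stable R
  ⊥♯ = record
    { at       = λ _ → ⊥
    ; isStable = record
      { isCollection = λ p → ≈↾⇒∈ℛ (Eq.sym (↾-⊥ (subset p)))
      ; bounded      = λ _ _ → refl
      ; consistent   = λ _ _ _ → minimum _
      }
    }

  restrict : Stable R → Subset n → Stable R
  restrict r Y = record
    { at       = λ p → at r p ↾ Y
    ; isStable = record
      { isCollection = λ p → ↾-∈ℛ Y (isCollection (isStable r) p)
      ; bounded      = λ _ _ → refl
      ; consistent   = λ x y z →
          trans (↾-mono Y (consistent (isStable r) x y z))
          (trans (reflexive (↾-comm _ _ Y))
          (↾-mono _ (↾-∧ _ _ Y)))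
      }
    }

  join : PreservesJoins R → Stable R → Stable R → Stable R
  join ↾-∨ r s = record
    { at       = λ p → at r p ∨ at s p
    ; isStable = record
      { isCollection = λ p →
          ∨-∈ℛ ↾-∨ p (isCollection (isStable r) p) (isCollection (isStable s) p)
      ; bounded      = λ _ _ → refl
      ; consistent   = λ x y z → ∨-least
          (trans (consistent (isStable r) x y z)
                 (viaThird-mono (λ p → x≤x∨y (at r p) (at s p)) x y z))
          (trans (consistent (isStable s) x y z)
                 (viaThird-mono (λ p → y≤x∨y (at r p) (at s p)) x y z))
      }
    }

  -- From r_xy = ⊥, consistency through y gives r_xz = ⊥ for every z, and then
  -- consistency through x gives r_zw = ⊥ for all z and w.
  ⊥-spreads : ∀ (r : Stable R) p → at r p ≈ ⊥ → ∀ q → at r q ≈ ⊥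
  ⊥-spreads r = []₂-elim (λ p → at r p ≈ ⊥ → ∀ q → at r q ≈ ⊥) λ x y rxy≈⊥ →
    let
      ⊥-restricts : ∀ {u Y} → u ⊑ ⊥ → u ↾ Y ⊑ ⊥
      ⊥-restricts {Y = Y} u⊑⊥ = trans (↾-mono Y u⊑⊥) (reflexive (↾-⊥ Y))

      rxz⊑⊥ : ∀ z → at r ⟅ x , z ⟆ ⊑ ⊥
      rxz⊑⊥ z = trans (consistent (isStable r) x z y)
        (⊥-restricts (trans (x∧y≤x _ _) (reflexive rxy≈⊥)))

      rzw⊑⊥ : ∀ z w → at r ⟅ z , w ⟆ ⊑ ⊥
      rzw⊑⊥ z w = trans (consistent (isStable r) z w x)
        (⊥-restricts (trans (x∧y≤y _ _) (rxz⊑⊥ w)))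
    in
    []₂-elim (λ q → at r q ≈ ⊥) λ z w → antisym (rzw⊑⊥ z w) (minimum _)

  -- The domain of stable collections

  -- Of 2-niceness only the existence of greatest solutions matters here, not
  -- that Kleene iteration reaches them.
  module Operations (nice : 2-Nice R) (↾-∨ : PreservesJoins R) where

    -- The greatest solution of the system bounded by the componentwise meets.
    greatestBelow : ∀ (r s : Stable R) →
      ∃[ g ] IsGreatestSolution R (λ p → at r p ∧ at s p) g
    greatestBelow r s =
      let g , greatest , _ = nice (λ p → at r p ∧ at s p) λ p →
            ∧-∈ℛ (isCollection (isStable r) p) (isCollection (isStable s) p)
      in g , greatest

    -- The meet is the greatest solution itself. The componentwise meet of stable
    -- collections is a collection, but its consistency does not follow.
    meet : Stable R → Stable R → Stable R
    meet r s = solution⇒stable (proj₁ (proj₂ (greatestBelow r s)))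

    operations : StableOperations R
    operations = record
      { _∨♯_    = join ↾-∨
      ; _∧♯_    = meet
      ; _↾♯_    = restrict
      ; ∨♯-spec = λ _ _ _ → Eq.refl
      ; ∧♯-spec = λ r s → proj₂ (greatestBelow r s)
      ; ↾♯-spec = λ _ _ _ → Eq.refl
      }

    meet-⊑ : ∀ r s p → at (meet r s) p ⊑ at r p ∧ at s p
    meet-⊑ r s = solution-⊑ (proj₁ (proj₂ (greatestBelow r s)))

    isBoundedLattice♯ :
      IsBoundedLattice (_≈♯_ R) (_⊑♯_ R) (join ↾-∨) meet ⊤♯ ⊥♯
    isBoundedLattice♯ = record
      { isLattice = record
        { isPartialOrder = record
          { isPreorder = record
            { isEquivalence = record
              { refl  = λ _ → Eq.refl
              ; sym   = λ r≈s p → Eq.sym (r≈s p)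
              ; trans = λ r≈s s≈t p → Eq.trans (r≈s p) (s≈t p)
              }
            ; reflexive = λ r≈s p → reflexive (r≈s p)
            ; trans     = λ r⊑s s⊑t p → trans (r⊑s p) (s⊑t p)
            }
          ; antisym = λ r⊑s s⊑r p → antisym (r⊑s p) (s⊑r p)
          }
        ; supremum = λ r s →
            (λ p → x≤x∨y (at r p) (at s p)) ,
            (λ p → y≤x∨y (at r p) (at s p)) ,
            (λ t r⊑t s⊑t p → ∨-least (r⊑t p) (s⊑t p))
        ; infimum = λ r s →
            (λ p → trans (meet-⊑ r s p) (x∧y≤x _ _)) ,
            (λ p → trans (meet-⊑ r s p) (x∧y≤y _ _)) ,
            (λ t t⊑r t⊑s → proj₂ (proj₂ (greatestBelow r s)) (at t)
              (stable⇒solution t λ p → ∧-greatest (t⊑r p) (t⊑s p)))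
        }
      ; maximum = λ r p → maximum (at r p)
      ; minimum = λ r p → minimum (at r p)
      }

    restrict-∅-⊤ : ∀ r → ¬ (_≈♯_ R r ⊥♯) → _≈♯_ R (restrict r ∅) ⊤♯
    restrict-∅-⊤ r r≉⊥ p = ↾-∅-⊤ (at r p) λ rp≈⊥ → r≉⊥ (⊥-spreads r p rp≈⊥)

    isRelationalDomain♯ :
      IsRelationalDomain (_≈♯_ R) (_⊑♯_ R) (join ↾-∨) meet ⊤♯ ⊥♯ restrict
    isRelationalDomain♯ = record
      { isBoundedLattice = isBoundedLattice♯
      ; ↾-mono           = λ Y r⊑s p → ↾-mono Y (r⊑s p)
      ; ↾-𝒳              = λ r p → ↾-𝒳 (at r p)
      ; ↾-∅-⊥            = λ r r≈⊥ p → ↾-∅-⊥ (at r p) (r≈⊥ p)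
      ; ↾-∅-⊤            = restrict-∅-⊤
      ; ↾-antitone       = λ r Y₁⊆Y₂ p → ↾-antitone (at r p) Y₁⊆Y₂
      ; ↾-↾              = λ r Y₁ Y₂ p → ↾-↾ (at r p) Y₁ Y₂
      }

    decomposition : ∀ r →
      _≈♯_ R r (foldr meet ⊤♯ (map (λ p → restrict r (subset p)) (pairs n)))
    decomposition r q = antisym (below q) (trans (above q) atq)
      where
      open FiniteMeet isBoundedLattice♯

      restrictions : List (Stable R)
      restrictions = map (λ p → restrict r (subset p)) (pairs n)

      below : _⊑♯_ R r (foldr meet ⊤♯ restrictions)
      below = ⋀-greatest {z = r} restrictions r⊑restriction
        where
        r⊑restriction : ∀ {s} → s ∈ restrictions → _⊑♯_ R r s
        r⊑restriction s∈ with ∈-map⁻ (λ p → restrict r (subset p)) s∈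
        ... | p , _ , ≡.refl = λ q′ → ↾-extensive (at r q′) (subset p)

      above : _⊑♯_ R (foldr meet ⊤♯ restrictions) (restrict r (subset q))
      above = ⋀-lower (∈-map⁺ (λ p → restrict r (subset p)) (∈-pairs q))

      atq : at r q ↾ subset q ⊑ at r q
      atq = reflexive (Eq.sym (∈ℛ⇒≈↾ (isCollection (isStable r) q)))

    is2Decomposable : Is2DecomposableRelationalDomain
      (_≈♯_ R) (_⊑♯_ R) (join ↾-∨) meet ⊤♯ ⊥♯ restrict
    is2Decomposable = record
      { isRelationalDomain        = isRelationalDomain♯
      ; decomposes                = decomposition
      ; restrictionPreservesJoins = λ r s p q → ↾-∨ (at r q) (at s q) p
      }

theorem3 : ∀ {c ℓ₁ ℓ₂ : Level} {n : ℕ} (R : RelationalDomain n c ℓ₁ ℓ₂) →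
    2-Nice R → PreservesJoins R →
    Σ[ ops ∈ StableOperations R ] (let open StableOperations ops in
    ∃[ ⊤♯ ] ∃[ ⊥♯ ]
    Is2DecomposableRelationalDomain (_≈♯_ R) (_⊑♯_ R) _∨♯_ _∧♯_ ⊤♯ ⊥♯ _↾♯_)
theorem3 R nice ↾-∨ = operations , ⊤♯ , ⊥♯ , is2Decomposable
  where
  open StableDomain R
  open Operations nice ↾-∨
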